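{- Let $k\ge 1$ be an integer. The $k$-polymatroid Tutte polynomial $T_k$ is multiplicative on direct sums: if $P_1=(E_1,r_1)$ and $P_2=(E_2,r_2)$ are $k$-polymatroids with $E_1\cap E_2=\emptyset$, then $$T_k(P_1\oplus P_2;x,y)=T_k(P_1;x,y)\,T_k(P_2;x,y).$$
   Context: A polymatroid is a pair $P=(E,r)$ with $E$ a finite set and $r:2^E\to\mathbb{Z}$ such that $r(\emptyset)=0$, $r(A)\le r(B)$ whenever $A\subseteq B$, and $r(A)+r(B)\ge r(A\cup B)+r(A\cap B)$ for all $A,B\subseteq E$. It is a $k$-polymatroid if $r(\{e\})\le k$ for all $e\in E$. $k$-polymatroid Tutte polynomial: $T_k(P;x,y)=\sum_{A\subseteq E}(x-1)^{r(E)-r(A)}(y-1)^{k|A|-r(A)}$. Direct sum of $P_1,P_2$ with disjoint groundsets: $P_1\oplus P_2=(E_1\cup E_2,r)$ with $r(X)=r_1(X\cap E_1)+r_2(X\cap E_2)$. -}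

module Defs where

open import Algebra.Bundles.Raw using (RawRing)
import Algebra.Definitions.RawSemiring as RawSemiringDefs
open import Data.Fin.Base using (Fin)
open import Data.Fin.Subset
open import Data.Fin.Subset.Properties
open import Data.Integer.Base as ℤ using (ℤ; +_; 0ℤ)
import Data.Integer.Properties as ℤ
open import Data.Integer.Tactic.RingSolver using (solve-∀)
open import Data.List.Base as List using (List; []; _∷_; _++_; filter; foldr)
open import Data.Nat.Base as ℕ using (ℕ; zero; suc)
import Data.Nat.Properties as ℕ
open import Data.Nat.Induction using (<-wellFounded)
open import Data.Product.Base using (_,_; proj₁; proj₂)
open import Data.Sum.Base using (inj₁; inj₂; [_,_]′)
open import Data.Vec.Base as Vec using ([]; _∷_)
open import Function.Base using (_∘_; id)
open import Induction.WellFounded using (Acc; acc)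
open import Relation.Nullary using (yes; no; contradiction)
open import Relation.Binary.PropositionalEquality
  using (_≡_; refl; sym; trans; cong; cong₂; subst)

private
  variable
    N : ℕ

-- R[t] for a ring R: a polynomial is the list of its coefficients, constant
-- term first.  Trailing zeros are allowed, so equality is equality of all
-- coefficients.
module Polynomial {c ℓ} (R : RawRing c ℓ) where
  open RawRing R

  Poly : Set c
  Poly = List Carrier

  coeff : Poly → ℕ → Carrier
  coeff []      n       = 0#
  coeff (a ∷ p) zero    = a
  coeff (a ∷ p) (suc n) = coeff p n

  infix  4 _≈ₚ_
  infixl 6 _+ₚ_
  infixl 7 _*ₚ_

  _≈ₚ_ : Poly → Poly → Set ℓ
  p ≈ₚ q = ∀ n → coeff p n ≈ coeff q n

  _+ₚ_ : Poly → Poly → Poly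
  []      +ₚ q       = q
  (a ∷ p) +ₚ []      = a ∷ p
  (a ∷ p) +ₚ (b ∷ q) = (a + b) ∷ (p +ₚ q)

  -- (a + t p) q = a q + t (p q)
  _*ₚ_ : Poly → Poly → Poly
  []      *ₚ q = []
  (a ∷ p) *ₚ q = List.map (a *_) q +ₚ (0# ∷ (p *ₚ q))

  const : Carrier → Poly
  const a = a ∷ []

  var : Poly
  var = 0# ∷ 1# ∷ []

  rawRing : RawRing c ℓ
  rawRing = record
    { Carrier = Poly
    ; _≈_     = _≈ₚ_
    ; _+_     = _+ₚ_
    ; _*_     = _*ₚ_
    ; -_      = List.map (-_)
    ; 0#      = []
    ; 1#      = const 1#
    }

ℤ[x] : RawRing _ _
ℤ[x] = Polynomial.rawRing ℤ.+-*-rawRing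

-- ℤ[x,y] is taken as (ℤ[x])[y].
ℤ[x,y] : RawRing _ _
ℤ[x,y] = Polynomial.rawRing ℤ[x]

open RawRing ℤ[x,y] public
  using (_≈_; _+_; _*_; -_; 0#; 1#)
  renaming (Carrier to Poly₂)
open RawSemiringDefs (RawRing.rawSemiring ℤ[x,y]) public using (_^_)

x y : Poly₂
x = Polynomial.const ℤ[x] (Polynomial.var ℤ.+-*-rawRing)
y = Polynomial.var ℤ[x]

-- The finite groundset E is a set of elements of an ambient finite set
-- Fin N, so that distinct polymatroids can have disjoint groundsets.  The
-- rank function is only meaningful on subsets of E: its values elsewhere
-- are unconstrained and never used.
record Polymatroid (N : ℕ) : Set where
  field
    E          : Subset N
    r          : Subset N → ℤ
    r-⊥        : r ⊥ ≡ 0ℤ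
    monotone   : ∀ {A B} → A ⊆ B → B ⊆ E → r A ℤ.≤ r B
    submodular : ∀ {A B} → A ⊆ E → B ⊆ E →
                 r A ℤ.+ r B ℤ.≥ r (A ∪ B) ℤ.+ r (A ∩ B)

open Polymatroid

IsKPolymatroid : ℕ → Polymatroid N → Set
IsKPolymatroid k P = ∀ {e} → e ∈ E P → r P ⁅ e ⁆ ℤ.≤ + k

Disjoint : Polymatroid N → Polymatroid N → Set
Disjoint P₁ P₂ = E P₁ ∩ E P₂ ≡ ⊥

private
  ∪⊆ : {A B C : Subset N} → A ⊆ C → B ⊆ C → A ∪ B ⊆ C
  ∪⊆ {A = A} {B} A⊆C B⊆C z∈ = [ A⊆C , B⊆C ]′ (x∈p∪q⁻ A B z∈)

  ∩-monoˡ : {A B : Subset N} (C : Subset N) → A ⊆ B → A ∩ C ⊆ B ∩ C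
  ∩-monoˡ {A = A} C A⊆B z∈ with x∈p∩q⁻ A C z∈
  ... | z∈A , z∈C = x∈p∩q⁺ (A⊆B z∈A , z∈C)

  ∩-distribʳ-∩ : (A B C : Subset N) → (A ∩ B) ∩ C ≡ (A ∩ C) ∩ (B ∩ C)
  ∩-distribʳ-∩ A B C = ⊆-antisym to from
    where
    to : (A ∩ B) ∩ C ⊆ (A ∩ C) ∩ (B ∩ C)
    to z∈ with x∈p∩q⁻ (A ∩ B) C z∈
    ... | z∈AB , z∈C with x∈p∩q⁻ A B z∈AB
    ... | z∈A , z∈B = x∈p∩q⁺ (x∈p∩q⁺ (z∈A , z∈C) , x∈p∩q⁺ (z∈B , z∈C))
    from : (A ∩ C) ∩ (B ∩ C) ⊆ (A ∩ B) ∩ C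
    from z∈ with x∈p∩q⁻ (A ∩ C) (B ∩ C) z∈
    ... | z∈AC , z∈BC with x∈p∩q⁻ A C z∈AC | x∈p∩q⁻ B C z∈BC
    ... | z∈A , z∈C | z∈B , _ = x∈p∩q⁺ (x∈p∩q⁺ (z∈A , z∈B) , z∈C)

  ⁅⁆⊆ : {A : Subset N} {e : Fin N} → e ∈ A → ⁅ e ⁆ ⊆ A
  ⁅⁆⊆ {A = A} {e} e∈A z∈ = subst (_∈ A) (sym (x∈⁅y⁆⇒x≡y e z∈)) e∈A

  interchange : ∀ a b c d →
                (a ℤ.+ b) ℤ.+ (c ℤ.+ d) ≡ (a ℤ.+ c) ℤ.+ (b ℤ.+ d)
  interchange = solve-∀

-- The construction makes sense for arbitrary groundsets in Fin N;
-- it is the direct sum when these are disjoint.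
infixl 6 _⊕_
_⊕_ : Polymatroid N → Polymatroid N → Polymatroid N
_⊕_ {N} P₁ P₂ = record
  { E          = E P₁ ∪ E P₂
  ; r          = rank
  ; r-⊥        = cong₂ ℤ._+_ (empty P₁) (empty P₂)
  ; monotone   = λ A⊆B _ → ℤ.+-mono-≤ (mono P₁ A⊆B) (mono P₂ A⊆B)
  ; submodular = λ {A} {B} _ _ → sub A B
  }
  where
  rank : Subset N → ℤ
  rank X = r P₁ (X ∩ E P₁) ℤ.+ r P₂ (X ∩ E P₂)

  empty : (P : Polymatroid N) → r P (⊥ ∩ E P) ≡ 0ℤ
  empty P = trans (cong (r P) (∩-zeroˡ (E P))) (r-⊥ P)

  mono : (P : Polymatroid N) {A B : Subset N} → A ⊆ B →
         r P (A ∩ E P) ℤ.≤ r P (B ∩ E P)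
  mono P {A} {B} A⊆B = monotone P (∩-monoˡ (E P) A⊆B) (p∩q⊆q B (E P))

  sub₁ : (P : Polymatroid N) (A B : Subset N) →
         r P ((A ∪ B) ∩ E P) ℤ.+ r P ((A ∩ B) ∩ E P) ℤ.≤
         r P (A ∩ E P) ℤ.+ r P (B ∩ E P)
  sub₁ P A B
    rewrite ∩-distribʳ-∪ (E P) A B | ∩-distribʳ-∩ A B (E P)
    = submodular P (p∩q⊆q A (E P)) (p∩q⊆q B (E P))

  sub : ∀ A B → rank (A ∪ B) ℤ.+ rank (A ∩ B) ℤ.≤ rank A ℤ.+ rank B
  sub A B = begin
    rank (A ∪ B) ℤ.+ rank (A ∩ B)
      ≡⟨ interchange (r P₁ ((A ∪ B) ∩ E P₁)) _ _ _ ⟩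
    _ ≤⟨ ℤ.+-mono-≤ (sub₁ P₁ A B) (sub₁ P₂ A B) ⟩
    _ ≡⟨ interchange (r P₁ (A ∩ E P₁)) _ _ _ ⟩
    rank A ℤ.+ rank B ∎
    where open ℤ.≤-Reasoning

⊕-isKPolymatroid : ∀ {k} (P₁ P₂ : Polymatroid N) → Disjoint P₁ P₂ →
                   IsKPolymatroid k P₁ → IsKPolymatroid k P₂ →
                   IsKPolymatroid k (P₁ ⊕ P₂)
⊕-isKPolymatroid {N} {k} P₁ P₂ disj k₁ k₂ {e} e∈ =
  [ (λ e∈₁ → bound (trans (cong₂ ℤ._+_ (hit P₁ e∈₁) (miss P₂ λ e∈₂ → clash e∈₁ e∈₂))
                          (ℤ.+-identityʳ _)) (k₁ e∈₁))
  , (λ e∈₂ → bound (trans (cong₂ ℤ._+_ (miss P₁ λ e∈₁ → clash e∈₁ e∈₂) (hit P₂ e∈₂))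
                          (ℤ.+-identityˡ _)) (k₂ e∈₂))
  ]′ (x∈p∪q⁻ (E P₁) (E P₂) e∈)
  where
  clash : e ∈ E P₁ → e ∉ E P₂
  clash e∈₁ e∈₂ = ∉⊥ (subst (e ∈_) disj (x∈p∩q⁺ (e∈₁ , e∈₂)))

  bound : ∀ {i j} → i ≡ j → j ℤ.≤ + k → i ℤ.≤ + k
  bound refl j≤k = j≤k

  hit : (P : Polymatroid N) → e ∈ E P → r P (⁅ e ⁆ ∩ E P) ≡ r P ⁅ e ⁆
  hit P e∈E = cong (r P) (⊆-antisym (p∩q⊆p ⁅ e ⁆ (E P))
                                    (λ z∈ → x∈p∩q⁺ (z∈ , ⁅⁆⊆ e∈E z∈)))

  miss : (P : Polymatroid N) → e ∉ E P → r P (⁅ e ⁆ ∩ E P) ≡ 0ℤ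
  miss P e∉E = trans (cong (r P) (Empty-unique none)) (r-⊥ P)
    where
    none : Empty (⁅ e ⁆ ∩ E P)
    none (z , z∈) with x∈p∩q⁻ ⁅ e ⁆ (E P) z∈
    ... | z∈e , z∈E = e∉E (subst (_∈ E P) (x∈⁅y⁆⇒x≡y e z∈e) z∈E)

subsets : ∀ N → List (Subset N)
subsets zero    = [] ∷ []
subsets (suc N) = List.map (outside ∷_) (subsets N) ++ List.map (inside ∷_) (subsets N)

∑⊆ : Subset N → (Subset N → Poly₂) → Poly₂
∑⊆ {N} E f = foldr _+_ 0# (List.map f (filter (_⊆? E) (subsets N)))

-- The exponents r(E) - r(A) and k|A| - r(A).  The absolute value only serves
-- to land in ℕ: the integers are nonnegative for A ⊆ E in a k-polymatroid,
-- as shown by +corank and +nullity.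
corank : Polymatroid N → Subset N → ℕ
corank P A = ℤ.∣ r P (E P) ℤ.- r P A ∣

nullity : ℕ → Polymatroid N → Subset N → ℕ
nullity k P A = ℤ.∣ + (k ℕ.* ∣ A ∣) ℤ.- r P A ∣

T : ℕ → Polymatroid N → Poly₂
T k P = ∑⊆ (E P) λ A → (x + - 1#) ^ corank P A * (y + - 1#) ^ nullity k P A

+corank : (P : Polymatroid N) {A : Subset N} → A ⊆ E P →
          + corank P A ≡ r P (E P) ℤ.- r P A
+corank P A⊆E = ℤ.0≤i⇒+∣i∣≡i (ℤ.i≤j⇒0≤j-i (monotone P A⊆E id))

rank≤k*size : ∀ {k} (P : Polymatroid N) → IsKPolymatroid k P →
              {A : Subset N} → A ⊆ E P → r P A ℤ.≤ + (k ℕ.* ∣ A ∣)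
rank≤k*size {N} {k} P isK {A} A⊆E = go A A⊆E (<-wellFounded ∣ A ∣)
  where
  go : ∀ A → A ⊆ E P → Acc ℕ._<_ ∣ A ∣ → r P A ℤ.≤ + (k ℕ.* ∣ A ∣)
  go A A⊆E (acc rs) with nonempty? A
  ... | no  A≡∅ rewrite Empty-unique A≡∅ | r-⊥ P = ℤ.+≤+ ℕ.z≤n
  ... | yes (e , e∈A) = begin
    r P A                            ≤⟨ monotone P A⊆ (∪⊆ B⊆E e⊆E) ⟩
    r P (B ∪ ⁅ e ⁆)                  ≡⟨ ℤ.+-identityʳ _ ⟨
    r P (B ∪ ⁅ e ⁆) ℤ.+ 0ℤ           ≡⟨ cong (λ i → r P (B ∪ ⁅ e ⁆) ℤ.+ i) (r-⊥ P) ⟨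
    r P (B ∪ ⁅ e ⁆) ℤ.+ r P ⊥        ≤⟨ ℤ.+-monoʳ-≤ (r P (B ∪ ⁅ e ⁆)) (monotone P (⊆-min _) (B⊆E ∘ p∩q⊆p B ⁅ e ⁆)) ⟩
    r P (B ∪ ⁅ e ⁆) ℤ.+ r P (B ∩ ⁅ e ⁆) ≤⟨ submodular P B⊆E e⊆E ⟩
    r P B ℤ.+ r P ⁅ e ⁆              ≤⟨ ℤ.+-mono-≤ (go B B⊆E (rs smaller)) (isK (A⊆E e∈A)) ⟩
    + (k ℕ.* ∣ B ∣ ℕ.+ k)            ≡⟨ cong +_ (trans (ℕ.+-comm _ k) (sym (ℕ.*-suc k ∣ B ∣))) ⟩
    + (k ℕ.* suc ∣ B ∣)              ≤⟨ ℤ.+≤+ (ℕ.*-monoʳ-≤ k smaller) ⟩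
    + (k ℕ.* ∣ A ∣)                  ∎
    where
    open ℤ.≤-Reasoning
    B : Subset N
    B = A Data.Fin.Subset.- e
    smaller : ∣ B ∣ ℕ.< ∣ A ∣
    smaller = x∈p⇒∣p-x∣<∣p∣ e∈A
    B⊆E : B ⊆ E P
    B⊆E = A⊆E ∘ p─q⊆p A ⁅ e ⁆
    e⊆E : ⁅ e ⁆ ⊆ E P
    e⊆E = ⁅⁆⊆ (A⊆E e∈A)
    A⊆ : A ⊆ B ∪ ⁅ e ⁆
    A⊆ {z} z∈A with z ∈? ⁅ e ⁆
    ... | yes z∈e = x∈p∪q⁺ (inj₂ z∈e)
    ... | no  z∉e = x∈p∪q⁺ (inj₁ (x∈p∧x∉q⇒x∈p─q z∈A z∉e))

+nullity : ∀ {k} (P : Polymatroid N) → IsKPolymatroid k P →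
           {A : Subset N} → A ⊆ E P →
           + nullity k P A ≡ + (k ℕ.* ∣ A ∣) ℤ.- r P A
+nullity P isK A⊆E = ℤ.0≤i⇒+∣i∣≡i (ℤ.i≤j⇒0≤j-i (rank≤k*size P isK A⊆E))

{-# OPTIONS --safe #-}

-- Since E₁ and E₂ are disjoint, the subsets of E₁ ∪ E₂ are the unions A ∪ B with
-- A ⊆ E₁ and B ⊆ E₂, each arising once.  Both exponents are additive along this
-- decomposition, so the sum over E₁ ∪ E₂ factors as a product of two sums.
module Submission where

open import Algebra.Bundles using (CommutativeMonoid; CommutativeSemiring)
open import Algebra.Bundles.Raw using (RawRing)
import Algebra.Properties.CommutativeSemigroup as CommutativeSemigroupProperties
import Algebra.Properties.Semiring.Exp as Exp
open import Algebra.Structures using (IsCommutativeSemiring; IsCommutativeMonoid)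
open import Algebra.Structures.Biased using (isCommutativeSemiringˡ)
open import Data.Bool.Base using (true; false)
open import Data.Fin.Subset
  using (Subset; ⊥; _∈_; _⊆_; _∩_; _∪_; ∣_∣; inside; outside)
open import Data.Fin.Subset.Properties
open import Data.Integer.Base as ℤ using (+_)
import Data.Integer.Properties as ℤ
open import Data.Integer.Tactic.RingSolver using (solve-∀)
open import Data.List.Base as List using (List; []; _∷_; _++_; filter; foldr)
open import Data.List.Properties using (filter-++; ++-identityʳ; map-∘)
open import Data.List.Relation.Unary.All as All using (All; []; _∷_)
import Data.List.Relation.Unary.All.Properties as All
open import Data.Nat.Base as ℕ using (ℕ; zero; suc; _≤_)
import Data.Nat.Properties as ℕ
open import Data.Product.Base using (_,_)
open import Data.Sum.Base using (inj₁; inj₂)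
open import Data.Vec.Base using ([]; _∷_)
import Data.Vec.Properties as Vec
open import Function.Base using (_∘_; id)
open import Relation.Binary.Bundles using (Setoid)
open import Relation.Binary.Structures using (IsEquivalence)
open import Relation.Binary.PropositionalEquality as ≡ using (_≡_; cong; cong₂; subst; subst₂)
import Relation.Binary.Reasoning.Setoid as SetoidReasoning
open import Relation.Nullary using (does; contradiction)
open import Defs using (module Polynomial; subsets)

-- Polynomials over a commutative semiring form a commutative semiring.

module PolynomialSemiring {c ℓ} (R : RawRing c ℓ)
  (isCommutativeSemiring : IsCommutativeSemiring
    (RawRing._≈_ R) (RawRing._+_ R) (RawRing._*_ R) (RawRing.0# R) (RawRing.1# R))
  where

  open RawRing R
  open Polynomial R
  private
    S : CommutativeSemiring c ℓ
    S = record { isCommutativeSemiring = isCommutativeSemiring }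
    module S = CommutativeSemiring S

  -- p ≈ₚ q unfolds to a function type, from which p and q cannot be inferred.
  infix 4 _≋_
  record _≋_ (p q : Poly) : Set ℓ where
    constructor coeffwise
    field coeff-≈ : p ≈ₚ q
  open _≋_ public

  ≋-setoid : Setoid c ℓ
  ≋-setoid = record
    { Carrier       = Poly
    ; _≈_           = _≋_
    ; isEquivalence = record
      { refl  = coeffwise λ _ → S.refl
      ; sym   = λ p≋q → coeffwise λ n → S.sym (coeff-≈ p≋q n)
      ; trans = λ p≋q q≋r → coeffwise λ n → S.trans (coeff-≈ p≋q n) (coeff-≈ q≋r n)
      }
    }

  open Setoid ≋-setoid using (refl; sym; trans; isEquivalence)
  open SetoidReasoning ≋-setoid

  -- `_≋_` may relate lists of different lengths, so `+ₚ-cong` is checked degree by degree through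
  -- this formula instead of by recursion on the lists.
  coeff-+ : ∀ p q n → coeff (p +ₚ q) n ≈ coeff p n + coeff q n
  coeff-+ []      q       n       = S.sym (S.+-identityˡ _)
  coeff-+ (a ∷ p) []      n       = S.sym (S.+-identityʳ _)
  coeff-+ (a ∷ p) (b ∷ q) zero    = S.refl
  coeff-+ (a ∷ p) (b ∷ q) (suc n) = coeff-+ p q n

  ∷-cong : ∀ {a b p q} → a ≈ b → p ≋ q → a ∷ p ≋ b ∷ q
  ∷-cong a≈b p≋q = coeffwise λ { zero → a≈b ; (suc n) → coeff-≈ p≋q n }

  -- Absorbs trailing zeros: `0# · p` and `p *ₚ []` are lists of zeros as long as `p`, equal to `[]`
  -- only up to `_≋_`.
  0∷[] : 0# ∷ [] ≋ []
  0∷[] = coeffwise λ { zero → S.refl ; (suc n) → S.refl }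

  +ₚ-cong : ∀ {p p′ q q′} → p ≋ p′ → q ≋ q′ → p +ₚ q ≋ p′ +ₚ q′
  +ₚ-cong {p} {p′} {q} {q′} p≋p′ q≋q′ = coeffwise λ n →
    S.trans (coeff-+ p q n)
      (S.trans (S.+-cong (coeff-≈ p≋p′ n) (coeff-≈ q≋q′ n)) (S.sym (coeff-+ p′ q′ n)))

  +ₚ-assoc : ∀ p q r → (p +ₚ q) +ₚ r ≋ p +ₚ (q +ₚ r)
  +ₚ-assoc []      q       r       = refl
  +ₚ-assoc (a ∷ p) []      r       = refl
  +ₚ-assoc (a ∷ p) (b ∷ q) []      = refl
  +ₚ-assoc (a ∷ p) (b ∷ q) (c ∷ r) = ∷-cong (S.+-assoc a b c) (+ₚ-assoc p q r)

  +ₚ-comm : ∀ p q → p +ₚ q ≋ q +ₚ p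
  +ₚ-comm []      []      = refl
  +ₚ-comm []      (b ∷ q) = refl
  +ₚ-comm (a ∷ p) []      = refl
  +ₚ-comm (a ∷ p) (b ∷ q) = ∷-cong (S.+-comm a b) (+ₚ-comm p q)

  +ₚ-identityʳ : ∀ p → p +ₚ [] ≋ p
  +ₚ-identityʳ p = +ₚ-comm p []

  +ₚ-isCommutativeMonoid : IsCommutativeMonoid _≋_ _+ₚ_ []
  +ₚ-isCommutativeMonoid = record
    { isMonoid = record
      { isSemigroup = record
        { isMagma = record { isEquivalence = isEquivalence ; ∙-cong = +ₚ-cong }
        ; assoc   = +ₚ-assoc
        }
      ; identity = (λ _ → refl) , +ₚ-identityʳ
      }
    ; comm = +ₚ-comm
    }

  +ₚ-commutativeMonoid : CommutativeMonoid c ℓ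
  +ₚ-commutativeMonoid = record { isCommutativeMonoid = +ₚ-isCommutativeMonoid }

  open CommutativeSemigroupProperties
    (CommutativeMonoid.commutativeSemigroup +ₚ-commutativeMonoid)
    using (interchange; x∙yz≈y∙xz)

  infixr 7 _·_
  -- Names the scalar part of a product, so that `(a ∷ p) *ₚ q` is definitionally
  -- `a · q +ₚ (0# ∷ p *ₚ q)`. Its laws treat the head of the left factor; induction treats the
  -- tail.
  _·_ : Carrier → Poly → Poly
  a · p = List.map (a *_) p

  coeff-· : ∀ a p n → coeff (a · p) n ≈ a * coeff p n
  coeff-· a []      n       = S.sym (S.zeroʳ a)
  coeff-· a (b ∷ p) zero    = S.refl
  coeff-· a (b ∷ p) (suc n) = coeff-· a p n

  ·-cong : ∀ {a b p q} → a ≈ b → p ≋ q → a · p ≋ b · q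
  ·-cong {a} {b} {p} {q} a≈b p≋q = coeffwise λ n →
    S.trans (coeff-· a p n) (S.trans (S.*-cong a≈b (coeff-≈ p≋q n)) (S.sym (coeff-· b q n)))

  ·-distribˡ-+ₚ : ∀ a p q → a · (p +ₚ q) ≋ a · p +ₚ a · q
  ·-distribˡ-+ₚ a []      q       = refl
  ·-distribˡ-+ₚ a (b ∷ p) []      = refl
  ·-distribˡ-+ₚ a (b ∷ p) (c ∷ q) = ∷-cong (S.distribˡ a b c) (·-distribˡ-+ₚ a p q)

  ·-identity : ∀ p → 1# · p ≋ p
  ·-identity []      = refl
  ·-identity (a ∷ p) = ∷-cong (S.*-identityˡ a) (·-identity p)

  ·-zero : ∀ p → 0# · p ≋ []
  ·-zero []      = refl
  ·-zero (a ∷ p) = trans (∷-cong (S.zeroˡ a) (·-zero p)) 0∷[]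

  ·-assoc : ∀ a b p → (a * b) · p ≋ a · b · p
  ·-assoc a b []      = refl
  ·-assoc a b (c ∷ p) = ∷-cong (S.*-assoc a b c) (·-assoc a b p)

  *ₚ-zeroʳ : ∀ p → p *ₚ [] ≋ []
  *ₚ-zeroʳ []      = refl
  *ₚ-zeroʳ (a ∷ p) = trans (∷-cong S.refl (*ₚ-zeroʳ p)) 0∷[]

  *ₚ-congˡ : ∀ p {q q′} → q ≋ q′ → p *ₚ q ≋ p *ₚ q′
  *ₚ-congˡ []      q≋q′ = refl
  *ₚ-congˡ (a ∷ p) q≋q′ =
    +ₚ-cong (·-cong S.refl q≋q′) (∷-cong S.refl (*ₚ-congˡ p q≋q′))

  -- The mirror image of the defining recursion of `_*ₚ_`, now in the right factor. Comparing the
  -- two recursions gives `*ₚ-comm` by induction. Commutativity of the coefficients enters in the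
  -- constant term, `a * b` against `b * a`.
  *ₚ-∷ : ∀ p b q → p *ₚ (b ∷ q) ≋ b · p +ₚ (0# ∷ p *ₚ q)
  *ₚ-∷ []      b q = sym 0∷[]
  *ₚ-∷ (a ∷ p) b q = ∷-cong (S.+-congʳ (S.*-comm a b)) (begin
    a · q +ₚ p *ₚ (b ∷ q)               ≈⟨ +ₚ-cong refl (*ₚ-∷ p b q) ⟩
    a · q +ₚ (b · p +ₚ (0# ∷ p *ₚ q))   ≈⟨ x∙yz≈y∙xz (a · q) (b · p) _ ⟩
    b · p +ₚ (a · q +ₚ (0# ∷ p *ₚ q))   ∎)

  *ₚ-comm : ∀ p q → p *ₚ q ≋ q *ₚ p
  *ₚ-comm []      q = sym (*ₚ-zeroʳ q)
  *ₚ-comm (a ∷ p) q = begin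
    a · q +ₚ (0# ∷ p *ₚ q)   ≈⟨ +ₚ-cong refl (∷-cong S.refl (*ₚ-comm p q)) ⟩
    a · q +ₚ (0# ∷ q *ₚ p)   ≈⟨ *ₚ-∷ q a p ⟨
    q *ₚ (a ∷ p)             ∎

  -- Commuting the factors reduces the left argument to `*ₚ-congˡ`. A direct induction on `p ≋ p′`
  -- would have to treat lists that differ by trailing zeros.
  *ₚ-cong : ∀ {p p′ q q′} → p ≋ p′ → q ≋ q′ → p *ₚ q ≋ p′ *ₚ q′
  *ₚ-cong {p} {p′} {q} {q′} p≋p′ q≋q′ = begin
    p *ₚ q     ≈⟨ *ₚ-congˡ p q≋q′ ⟩
    p *ₚ q′    ≈⟨ *ₚ-comm p q′ ⟩
    q′ *ₚ p    ≈⟨ *ₚ-congˡ q′ p≋p′ ⟩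
    q′ *ₚ p′   ≈⟨ *ₚ-comm q′ p′ ⟩
    p′ *ₚ q′   ∎

  *ₚ-distribˡ-+ₚ : ∀ p q r → p *ₚ (q +ₚ r) ≋ p *ₚ q +ₚ p *ₚ r
  *ₚ-distribˡ-+ₚ []      q r = refl
  *ₚ-distribˡ-+ₚ (a ∷ p) q r = begin
    a · (q +ₚ r) +ₚ (0# ∷ p *ₚ (q +ₚ r))
      -- The head `0#` of the shifted list is rewritten as `0# + 0#`, so that the shift splits as a
      -- sum of two shifts.
      ≈⟨ +ₚ-cong (·-distribˡ-+ₚ a q r)
                 (∷-cong (S.sym (S.+-identityˡ 0#)) (*ₚ-distribˡ-+ₚ p q r)) ⟩
    (a · q +ₚ a · r) +ₚ ((0# ∷ p *ₚ q) +ₚ (0# ∷ p *ₚ r))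
      ≈⟨ interchange (a · q) (a · r) (0# ∷ p *ₚ q) (0# ∷ p *ₚ r) ⟩
    (a ∷ p) *ₚ q +ₚ (a ∷ p) *ₚ r ∎

  *ₚ-distribʳ-+ₚ : ∀ r p q → (p +ₚ q) *ₚ r ≋ p *ₚ r +ₚ q *ₚ r
  *ₚ-distribʳ-+ₚ r p q = begin
    (p +ₚ q) *ₚ r      ≈⟨ *ₚ-comm (p +ₚ q) r ⟩
    r *ₚ (p +ₚ q)      ≈⟨ *ₚ-distribˡ-+ₚ r p q ⟩
    r *ₚ p +ₚ r *ₚ q   ≈⟨ +ₚ-cong (*ₚ-comm r p) (*ₚ-comm r q) ⟩
    p *ₚ r +ₚ q *ₚ r   ∎

  ·-*ₚ-assoc : ∀ a p q → (a · p) *ₚ q ≋ a · (p *ₚ q)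
  ·-*ₚ-assoc a []      q = refl
  ·-*ₚ-assoc a (b ∷ p) q = begin
    (a * b) · q +ₚ (0# ∷ (a · p) *ₚ q)
      -- Here `0#` becomes `a * 0#`, which exhibits the shifted list as a multiple by `a`.
      ≈⟨ +ₚ-cong (·-assoc a b q) (∷-cong (S.sym (S.zeroʳ a)) (·-*ₚ-assoc a p q)) ⟩
    a · b · q +ₚ a · (0# ∷ p *ₚ q)
      ≈⟨ ·-distribˡ-+ₚ a (b · q) (0# ∷ p *ₚ q) ⟨
    a · ((b ∷ p) *ₚ q) ∎

  0∷-*ₚ : ∀ p q → (0# ∷ p) *ₚ q ≋ 0# ∷ p *ₚ q
  0∷-*ₚ p q = +ₚ-cong (·-zero q) refl

  -- Distributing `r` over the unfolded `(a ∷ p) *ₚ q` leaves a scalar part, settled by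
  -- `·-*ₚ-assoc`, and a shifted part, where the shift moves outward by `0∷-*ₚ` and the induction
  -- hypothesis applies.
  *ₚ-assoc : ∀ p q r → (p *ₚ q) *ₚ r ≋ p *ₚ (q *ₚ r)
  *ₚ-assoc []      q r = refl
  *ₚ-assoc (a ∷ p) q r = begin
    (a · q +ₚ (0# ∷ p *ₚ q)) *ₚ r
      ≈⟨ *ₚ-distribʳ-+ₚ r (a · q) (0# ∷ p *ₚ q) ⟩
    (a · q) *ₚ r +ₚ (0# ∷ p *ₚ q) *ₚ r
      ≈⟨ +ₚ-cong (·-*ₚ-assoc a q r) (0∷-*ₚ (p *ₚ q) r) ⟩
    a · (q *ₚ r) +ₚ (0# ∷ (p *ₚ q) *ₚ r)
      ≈⟨ +ₚ-cong refl (∷-cong S.refl (*ₚ-assoc p q r)) ⟩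
    (a ∷ p) *ₚ (q *ₚ r) ∎

  *ₚ-identityˡ : ∀ p → const 1# *ₚ p ≋ p
  *ₚ-identityˡ p = begin
    1# · p +ₚ (0# ∷ [])   ≈⟨ +ₚ-cong (·-identity p) 0∷[] ⟩
    p +ₚ []               ≈⟨ +ₚ-identityʳ p ⟩
    p                     ∎

  *ₚ-identityʳ : ∀ p → p *ₚ const 1# ≋ p
  *ₚ-identityʳ p = trans (*ₚ-comm p (const 1#)) (*ₚ-identityˡ p)

  ≈ₚ-isEquivalence : IsEquivalence _≈ₚ_
  ≈ₚ-isEquivalence = record
    { refl  = λ _ → S.refl
    ; sym   = λ p≈q n → S.sym (p≈q n)
    ; trans = λ p≈q q≈r n → S.trans (p≈q n) (q≈r n)
    }

  -- Restates the laws for `_≈ₚ_`, the equality of `rawRing`. The result then has the form of the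
  -- hypothesis of this module, so the construction can be iterated.
  ≈ₚ-isCommutativeSemiring : IsCommutativeSemiring _≈ₚ_ _+ₚ_ _*ₚ_ [] (const 1#)
  ≈ₚ-isCommutativeSemiring = isCommutativeSemiringˡ record
    { +-isCommutativeMonoid = record
      { isMonoid = record
        { isSemigroup = record
          { isMagma = record
            { isEquivalence = ≈ₚ-isEquivalence
            ; ∙-cong = λ {p} {p′} {q} {q′} e f →
                coeff-≈ (+ₚ-cong {p} {p′} {q} {q′} (coeffwise e) (coeffwise f))
            }
          ; assoc = λ p q r → coeff-≈ (+ₚ-assoc p q r)
          }
        ; identity = (λ _ _ → S.refl) , λ p → coeff-≈ (+ₚ-identityʳ p)
        }
      ; comm = λ p q → coeff-≈ (+ₚ-comm p q)
      }
    ; *-isCommutativeMonoid = record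
      { isMonoid = record
        { isSemigroup = record
          { isMagma = record
            { isEquivalence = ≈ₚ-isEquivalence
            ; ∙-cong = λ {p} {p′} {q} {q′} e f →
                coeff-≈ (*ₚ-cong {p} {p′} {q} {q′} (coeffwise e) (coeffwise f))
            }
          ; assoc = λ p q r → coeff-≈ (*ₚ-assoc p q r)
          }
        ; identity = (λ p → coeff-≈ (*ₚ-identityˡ p)) , λ p → coeff-≈ (*ₚ-identityʳ p)
        }
      ; comm = λ p q → coeff-≈ (*ₚ-comm p q)
      }
    ; distribʳ = λ r p q → coeff-≈ (*ₚ-distribʳ-+ₚ r p q)
    ; zeroˡ    = λ _ _ → S.refl
    }

-- Subsets of a groundset, enumerated by recursion on the first coordinate.

filter-⊆-outside∷ : ∀ {N} s (E : Subset N) As →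
  filter (_⊆? (s ∷ E)) (List.map (outside ∷_) As) ≡
  List.map (outside ∷_) (filter (_⊆? E) As)
filter-⊆-outside∷ s E []       = ≡.refl
-- For a candidate with head `outside`, `_⊆?_` reduces to the test on the tails whatever `s` is, so
-- one split on `does` computes both sides.
filter-⊆-outside∷ s E (A ∷ As) with does (A ⊆? E)
... | true  = cong ((outside ∷ A) ∷_) (filter-⊆-outside∷ s E As)
... | false = filter-⊆-outside∷ s E As

filter-⊆-inside∷inside∷ : ∀ {N} (E : Subset N) As →
  filter (_⊆? (inside ∷ E)) (List.map (inside ∷_) As) ≡
  List.map (inside ∷_) (filter (_⊆? E) As)
filter-⊆-inside∷inside∷ E []       = ≡.refl
filter-⊆-inside∷inside∷ E (A ∷ As) with does (A ⊆? E)
... | true  = cong ((inside ∷ A) ∷_) (filter-⊆-inside∷inside∷ E As)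
... | false = filter-⊆-inside∷inside∷ E As

filter-⊆-inside∷outside∷ : ∀ {N} (E : Subset N) As →
  filter (_⊆? (outside ∷ E)) (List.map (inside ∷_) As) ≡ []
filter-⊆-inside∷outside∷ E []       = ≡.refl
filter-⊆-inside∷outside∷ E (A ∷ As) = filter-⊆-inside∷outside∷ E As

subsetsOf : ∀ {N} → Subset N → List (Subset N)
subsetsOf {N} E = filter (_⊆? E) (subsets N)

subsetsOf-outside∷ : ∀ {N} (E : Subset N) →
  subsetsOf (outside ∷ E) ≡ List.map (outside ∷_) (subsetsOf E)
subsetsOf-outside∷ {N} E = begin
  filter (_⊆? (outside ∷ E)) (subsets (suc N))
    ≡⟨ filter-++ (_⊆? (outside ∷ E)) (List.map (outside ∷_) (subsets N)) _ ⟩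
  _ ≡⟨ cong₂ _++_ (filter-⊆-outside∷ outside E (subsets N))
                  (filter-⊆-inside∷outside∷ E (subsets N)) ⟩
  List.map (outside ∷_) (subsetsOf E) ++ []
    ≡⟨ ++-identityʳ _ ⟩
  List.map (outside ∷_) (subsetsOf E) ∎
  where open ≡.≡-Reasoning

subsetsOf-inside∷ : ∀ {N} (E : Subset N) →
  subsetsOf (inside ∷ E) ≡
  List.map (outside ∷_) (subsetsOf E) ++ List.map (inside ∷_) (subsetsOf E)
subsetsOf-inside∷ {N} E = ≡.trans
  (filter-++ (_⊆? (inside ∷ E)) (List.map (outside ∷_) (subsets N)) _)
  (cong₂ _++_ (filter-⊆-outside∷ inside E (subsets N))
              (filter-⊆-inside∷inside∷ E (subsets N)))

-- Sums over subsets in a commutative semiring.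

module SubsetSum {c ℓ} (S : CommutativeSemiring c ℓ) where
  open CommutativeSemiring S
  open Exp semiring
  open SetoidReasoning setoid

  ∑ : {A : Set} → List A → (A → Carrier) → Carrier
  ∑ as f = foldr _+_ 0# (List.map f as)

  ∑-map : {A B : Set} (g : A → B) (as : List A) (f : B → Carrier) →
    ∑ (List.map g as) f ≡ ∑ as (f ∘ g)
  ∑-map g as f = cong (foldr _+_ 0#) (≡.sym (map-∘ as))

  ∑-++ : {A : Set} (as bs : List A) (f : A → Carrier) →
    ∑ (as ++ bs) f ≈ ∑ as f + ∑ bs f
  ∑-++ []       bs f = sym (+-identityˡ _)
  ∑-++ (a ∷ as) bs f = trans (+-congˡ (∑-++ as bs f)) (sym (+-assoc _ _ _))

  ∑-cong-All : {A : Set} {as : List A} {f g : A → Carrier} →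
    All (λ a → f a ≈ g a) as → ∑ as f ≈ ∑ as g
  ∑-cong-All []       = refl
  ∑-cong-All (e ∷ es) = +-cong e (∑-cong-All es)

  ∑-cong : {A : Set} (as : List A) {f g : A → Carrier} →
    (∀ a → f a ≈ g a) → ∑ as f ≈ ∑ as g
  ∑-cong as f≈g = ∑-cong-All (All.universal f≈g as)

  -- Every entry of `subsetsOf E` has passed the filter, so `A ⊆ E` is available when summands are
  -- compared. The weights of a direct sum are shown to factor under exactly such inclusions.
  ∑-cong-⊆ : ∀ {N} (E : Subset N) {f g : Subset N → Carrier} →
    (∀ A → A ⊆ E → f A ≈ g A) → ∑ (subsetsOf E) f ≈ ∑ (subsetsOf E) g
  ∑-cong-⊆ {N} E f≈g = ∑-cong-All
    (All.map {P = _⊆ E} (λ {A} → f≈g A) (All.all-filter (_⊆? E) (subsets N)))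

  *-distribˡ-∑ : {A : Set} (c : Carrier) (as : List A) (f : A → Carrier) →
    ∑ as (λ a → c * f a) ≈ c * ∑ as f
  *-distribˡ-∑ c []       f = sym (zeroʳ c)
  *-distribˡ-∑ c (a ∷ as) f = trans (+-congˡ (*-distribˡ-∑ c as f)) (sym (distribˡ _ _ _))

  *-distribʳ-∑ : {A : Set} (c : Carrier) (as : List A) (f : A → Carrier) →
    ∑ as (λ a → f a * c) ≈ ∑ as f * c
  *-distribʳ-∑ c []       f = sym (zeroˡ c)
  *-distribʳ-∑ c (a ∷ as) f = trans (+-congˡ (*-distribʳ-∑ c as f)) (sym (distribʳ _ _ _))

  ∑-outside∷ : ∀ {N} (E : Subset N) f →
    ∑ (subsetsOf (outside ∷ E)) f ≈ ∑ (subsetsOf E) (f ∘ (outside ∷_))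
  ∑-outside∷ E f rewrite subsetsOf-outside∷ E = reflexive (∑-map _ (subsetsOf E) f)

  ∑-inside∷ : ∀ {N} (E : Subset N) f →
    ∑ (subsetsOf (inside ∷ E)) f ≈
    ∑ (subsetsOf E) (f ∘ (outside ∷_)) + ∑ (subsetsOf E) (f ∘ (inside ∷_))
  ∑-inside∷ E f rewrite subsetsOf-inside∷ E = trans
    (∑-++ (List.map (outside ∷_) (subsetsOf E)) _ f)
    (reflexive (cong₂ _+_ (∑-map _ (subsetsOf E) f) (∑-map _ (subsetsOf E) f)))

  ∑-+ : {A : Set} (as : List A) (f g : A → Carrier) →
    ∑ as (λ a → f a + g a) ≈ ∑ as f + ∑ as g
  ∑-+ []       f g = sym (+-identityˡ 0#)
  ∑-+ (a ∷ as) f g = trans (+-congˡ (∑-+ as f g)) (+-interchange _ _ _ _)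
    where
    open CommutativeSemigroupProperties +-commutativeSemigroup
      using () renaming (interchange to +-interchange)

  -- Induction on the ambient coordinates. Disjointness excludes a coordinate lying in both
  -- groundsets, since `⊥` has head `outside`. A coordinate in exactly one of them splits the sum on
  -- the left in two, and splits the matching sum on the right in the same way; a coordinate in
  -- neither splits nothing.
  ∑-∪ : ∀ {N} (E₁ E₂ : Subset N) → E₁ ∩ E₂ ≡ ⊥ → (f : Subset N → Carrier) →
    ∑ (subsetsOf (E₁ ∪ E₂)) f ≈
    ∑ (subsetsOf E₁) λ A → ∑ (subsetsOf E₂) λ B → f (A ∪ B)
  ∑-∪ [] [] _ f = sym (+-identityʳ _)
  ∑-∪ (inside ∷ E₁) (inside ∷ E₂) ()
  ∑-∪ (outside ∷ E₁) (outside ∷ E₂) disjoint f = begin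
    ∑ (subsetsOf (outside ∷ (E₁ ∪ E₂))) f
      ≈⟨ ∑-outside∷ (E₁ ∪ E₂) f ⟩
    ∑ (subsetsOf (E₁ ∪ E₂)) (f ∘ (outside ∷_))
      ≈⟨ ∑-∪ E₁ E₂ (Vec.∷-injectiveʳ disjoint) (f ∘ (outside ∷_)) ⟩
    (∑ (subsetsOf E₁) λ A → ∑ (subsetsOf E₂) λ B → f (outside ∷ (A ∪ B)))
      ≈⟨ ∑-cong (subsetsOf E₁) (λ A → ∑-outside∷ E₂ λ B → f ((outside ∷ A) ∪ B)) ⟨
    (∑ (subsetsOf E₁) λ A → ∑ (subsetsOf (outside ∷ E₂)) λ B → f ((outside ∷ A) ∪ B))
      ≈⟨ ∑-outside∷ E₁ _ ⟨
    (∑ (subsetsOf (outside ∷ E₁)) λ A → ∑ (subsetsOf (outside ∷ E₂)) λ B → f (A ∪ B)) ∎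
  ∑-∪ (inside ∷ E₁) (outside ∷ E₂) disjoint f = begin
    ∑ (subsetsOf (inside ∷ (E₁ ∪ E₂))) f
      ≈⟨ ∑-inside∷ (E₁ ∪ E₂) f ⟩
    ∑ (subsetsOf (E₁ ∪ E₂)) (f ∘ (outside ∷_)) + ∑ (subsetsOf (E₁ ∪ E₂)) (f ∘ (inside ∷_))
      ≈⟨ +-cong (∑-∪ E₁ E₂ (Vec.∷-injectiveʳ disjoint) (f ∘ (outside ∷_)))
                (∑-∪ E₁ E₂ (Vec.∷-injectiveʳ disjoint) (f ∘ (inside ∷_))) ⟩
    (∑ (subsetsOf E₁) λ A → ∑ (subsetsOf E₂) λ B → f (outside ∷ (A ∪ B))) +
    (∑ (subsetsOf E₁) λ A → ∑ (subsetsOf E₂) λ B → f (inside ∷ (A ∪ B)))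
      ≈⟨ +-cong (∑-cong (subsetsOf E₁) (λ A → ∑-outside∷ E₂ λ B → f ((outside ∷ A) ∪ B)))
                (∑-cong (subsetsOf E₁) (λ A → ∑-outside∷ E₂ λ B → f ((inside ∷ A) ∪ B))) ⟨
    (∑ (subsetsOf E₁) λ A → ∑ (subsetsOf (outside ∷ E₂)) λ B → f ((outside ∷ A) ∪ B)) +
    (∑ (subsetsOf E₁) λ A → ∑ (subsetsOf (outside ∷ E₂)) λ B → f ((inside ∷ A) ∪ B))
      ≈⟨ ∑-inside∷ E₁ _ ⟨
    (∑ (subsetsOf (inside ∷ E₁)) λ A → ∑ (subsetsOf (outside ∷ E₂)) λ B → f (A ∪ B)) ∎
  ∑-∪ (outside ∷ E₁) (inside ∷ E₂) disjoint f = begin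
    ∑ (subsetsOf (inside ∷ (E₁ ∪ E₂))) f
      ≈⟨ ∑-inside∷ (E₁ ∪ E₂) f ⟩
    ∑ (subsetsOf (E₁ ∪ E₂)) (f ∘ (outside ∷_)) + ∑ (subsetsOf (E₁ ∪ E₂)) (f ∘ (inside ∷_))
      ≈⟨ +-cong (∑-∪ E₁ E₂ (Vec.∷-injectiveʳ disjoint) (f ∘ (outside ∷_)))
                (∑-∪ E₁ E₂ (Vec.∷-injectiveʳ disjoint) (f ∘ (inside ∷_))) ⟩
    (∑ (subsetsOf E₁) λ A → ∑ (subsetsOf E₂) λ B → f (outside ∷ (A ∪ B))) +
    (∑ (subsetsOf E₁) λ A → ∑ (subsetsOf E₂) λ B → f (inside ∷ (A ∪ B)))
      -- The new coordinate belongs to `E₂`, so the split occurs in the inner sum: the two double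
      -- sums are first merged under the outer one.
      ≈⟨ ∑-+ (subsetsOf E₁) _ _ ⟨
    (∑ (subsetsOf E₁) λ A → (∑ (subsetsOf E₂) λ B → f (outside ∷ (A ∪ B))) +
                            (∑ (subsetsOf E₂) λ B → f (inside ∷ (A ∪ B))))
      ≈⟨ ∑-cong (subsetsOf E₁) (λ A → ∑-inside∷ E₂ λ B → f ((outside ∷ A) ∪ B)) ⟨
    (∑ (subsetsOf E₁) λ A → ∑ (subsetsOf (inside ∷ E₂)) λ B → f ((outside ∷ A) ∪ B))
      ≈⟨ ∑-outside∷ E₁ _ ⟨
    (∑ (subsetsOf (outside ∷ E₁)) λ A → ∑ (subsetsOf (inside ∷ E₂)) λ B → f (A ∪ B)) ∎

  -- Once the summand separates, distributivity applies twice: `u A` leaves the sum over `B`, and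
  -- then the sum of `v`, which is independent of `A`, leaves the sum over `A`.
  ∑-∪-* : ∀ {N} (E₁ E₂ : Subset N) → E₁ ∩ E₂ ≡ ⊥ → (f u v : Subset N → Carrier) →
    (∀ A B → A ⊆ E₁ → B ⊆ E₂ → f (A ∪ B) ≈ u A * v B) →
    ∑ (subsetsOf (E₁ ∪ E₂)) f ≈ ∑ (subsetsOf E₁) u * ∑ (subsetsOf E₂) v
  ∑-∪-* {N} E₁ E₂ disjoint f u v f≈u*v = begin
    ∑ (subsetsOf (E₁ ∪ E₂)) f
      ≈⟨ ∑-∪ E₁ E₂ disjoint f ⟩
    (∑ (subsetsOf E₁) λ A → ∑ (subsetsOf E₂) λ B → f (A ∪ B))
      ≈⟨ ∑-cong-⊆ E₁ (λ A A⊆E₁ → ∑-cong-⊆ E₂ (λ B B⊆E₂ → f≈u*v A B A⊆E₁ B⊆E₂)) ⟩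
    (∑ (subsetsOf E₁) λ A → ∑ (subsetsOf E₂) λ B → u A * v B)
      ≈⟨ ∑-cong (subsetsOf E₁) (λ A → *-distribˡ-∑ (u A) (subsetsOf E₂) v) ⟩
    (∑ (subsetsOf E₁) λ A → u A * ∑ (subsetsOf E₂) v)
      ≈⟨ *-distribʳ-∑ _ (subsetsOf E₁) u ⟩
    ∑ (subsetsOf E₁) u * ∑ (subsetsOf E₂) v ∎

  ^-*-homo-* : ∀ a b m m′ n n′ →
    a ^ (m ℕ.+ m′) * b ^ (n ℕ.+ n′) ≈ (a ^ m * b ^ n) * (a ^ m′ * b ^ n′)
  ^-*-homo-* a b m m′ n n′ = trans
    (*-cong (^-homo-* a m m′) (^-homo-* b n n′))
    (interchange (a ^ m) (a ^ m′) (b ^ n) (b ^ n′))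
    where open CommutativeSemigroupProperties *-commutativeSemigroup using (interchange)

-- Unions of subsets of disjoint groundsets.

∪-∩-cancelʳ : ∀ {N} {A B E₁ E₂ : Subset N} → E₁ ∩ E₂ ≡ ⊥ → A ⊆ E₁ → B ⊆ E₂ →
  (A ∪ B) ∩ E₁ ≡ A
∪-∩-cancelʳ {A = A} {B} {E₁} {E₂} disjoint A⊆E₁ B⊆E₂ = ⊆-antisym to from
  where
  to : (A ∪ B) ∩ E₁ ⊆ A
  to {z} z∈ with x∈p∩q⁻ (A ∪ B) E₁ z∈
  ... | z∈A∪B , z∈E₁ with x∈p∪q⁻ A B z∈A∪B
  ... | inj₁ z∈A = z∈A
  -- An element of `B` lying in `E₁` would belong to `E₁ ∩ E₂`.
  ... | inj₂ z∈B = contradiction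
    (subst (z ∈_) disjoint (x∈p∩q⁺ (z∈E₁ , B⊆E₂ z∈B))) ∉⊥

  from : A ⊆ (A ∪ B) ∩ E₁
  from z∈A = x∈p∩q⁺ (x∈p∪q⁺ (inj₁ z∈A) , A⊆E₁ z∈A)

∣∪∣-disjoint : ∀ {N} (A B : Subset N) → A ∩ B ≡ ⊥ → ∣ A ∪ B ∣ ≡ ∣ A ∣ ℕ.+ ∣ B ∣
∣∪∣-disjoint []            []            _        = ≡.refl
∣∪∣-disjoint (outside ∷ A) (outside ∷ B) disjoint = ∣∪∣-disjoint A B (Vec.∷-injectiveʳ disjoint)
∣∪∣-disjoint (inside  ∷ A) (outside ∷ B) disjoint =
  cong suc (∣∪∣-disjoint A B (Vec.∷-injectiveʳ disjoint))
∣∪∣-disjoint (outside ∷ A) (inside  ∷ B) disjoint = ≡.trans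
  (cong suc (∣∪∣-disjoint A B (Vec.∷-injectiveʳ disjoint))) (≡.sym (ℕ.+-suc ∣ A ∣ ∣ B ∣))

⊆-disjoint : ∀ {N} {A B E₁ E₂ : Subset N} → E₁ ∩ E₂ ≡ ⊥ → A ⊆ E₁ → B ⊆ E₂ → A ∩ B ≡ ⊥
⊆-disjoint {A = A} {B} disjoint A⊆E₁ B⊆E₂ = Empty-unique λ (z , z∈) →
  let z∈A , z∈B = x∈p∩q⁻ A B z∈
  in ∉⊥ (subst (z ∈_) disjoint (x∈p∩q⁺ (A⊆E₁ z∈A , B⊆E₂ z∈B)))

+-[-]-interchange : ∀ i j m n → (i ℤ.+ j) ℤ.- (m ℤ.+ n) ≡ (i ℤ.- m) ℤ.+ (j ℤ.- n)
+-[-]-interchange = solve-∀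

-- Rank, corank and nullity of a direct sum.

open import Defs
open Polymatroid

-- Intersecting `A ∪ B` with the two groundsets, as the rank of `_⊕_` does, recovers `A` and `B`.
-- The second case is the first with the roles exchanged.
r-⊕ : ∀ {N} (P₁ P₂ : Polymatroid N) → Disjoint P₁ P₂ →
  ∀ A B → A ⊆ E P₁ → B ⊆ E P₂ → r (P₁ ⊕ P₂) (A ∪ B) ≡ r P₁ A ℤ.+ r P₂ B
r-⊕ P₁ P₂ disjoint A B A⊆E₁ B⊆E₂ = cong₂ ℤ._+_
  (cong (r P₁) (∪-∩-cancelʳ disjoint A⊆E₁ B⊆E₂))
  (cong (r P₂) (≡.trans (cong (_∩ E P₂) (∪-comm A B))
    (∪-∩-cancelʳ (≡.trans (∩-comm (E P₂) (E P₁)) disjoint) B⊆E₂ A⊆E₁)))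

module _ {N} (P₁ P₂ : Polymatroid N) (disjoint : Disjoint P₁ P₂)
  {A B : Subset N} (A⊆E₁ : A ⊆ E P₁) (B⊆E₂ : B ⊆ E P₂) where

  -- Absolute values are not additive on integers of mixed sign. By `+corank`, which rests on
  -- monotonicity, both differences are nonnegative, so the integer identity ends in `+` of a
  -- natural number and taking `∣_∣` returns that number.
  corank-⊕ : corank (P₁ ⊕ P₂) (A ∪ B) ≡ corank P₁ A ℕ.+ corank P₂ B
  corank-⊕ = cong ℤ.∣_∣ (begin
    r (P₁ ⊕ P₂) (E P₁ ∪ E P₂) ℤ.- r (P₁ ⊕ P₂) (A ∪ B)
      ≡⟨ cong₂ ℤ._-_ (r-⊕ P₁ P₂ disjoint (E P₁) (E P₂) id id)
                      (r-⊕ P₁ P₂ disjoint A B A⊆E₁ B⊆E₂) ⟩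
    (r P₁ (E P₁) ℤ.+ r P₂ (E P₂)) ℤ.- (r P₁ A ℤ.+ r P₂ B)
      ≡⟨ +-[-]-interchange (r P₁ (E P₁)) (r P₂ (E P₂)) (r P₁ A) (r P₂ B) ⟩
    (r P₁ (E P₁) ℤ.- r P₁ A) ℤ.+ (r P₂ (E P₂) ℤ.- r P₂ B)
      ≡⟨ cong₂ ℤ._+_ (+corank P₁ A⊆E₁) (+corank P₂ B⊆E₂) ⟨
    + (corank P₁ A ℕ.+ corank P₂ B) ∎)
    where open ≡.≡-Reasoning

  -- As for the corank, but nonnegativity now comes from the bound `k` on the rank of single
  -- elements, through `+nullity`. The term `k ℕ.* ∣ A ∪ B ∣` splits because `A` and `B` inherit
  -- disjointness from the groundsets.
  nullity-⊕ : ∀ {k} → IsKPolymatroid k P₁ → IsKPolymatroid k P₂ →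
    nullity k (P₁ ⊕ P₂) (A ∪ B) ≡ nullity k P₁ A ℕ.+ nullity k P₂ B
  nullity-⊕ {k} isK₁ isK₂ = cong ℤ.∣_∣ (begin
    + (k ℕ.* ∣ A ∪ B ∣) ℤ.- r (P₁ ⊕ P₂) (A ∪ B)
      ≡⟨ cong₂ ℤ._-_
           (cong (λ n → + (k ℕ.* n)) (∣∪∣-disjoint A B (⊆-disjoint disjoint A⊆E₁ B⊆E₂)))
           (r-⊕ P₁ P₂ disjoint A B A⊆E₁ B⊆E₂) ⟩
    + (k ℕ.* (∣ A ∣ ℕ.+ ∣ B ∣)) ℤ.- (r P₁ A ℤ.+ r P₂ B)
      ≡⟨ cong (λ n → + n ℤ.- (r P₁ A ℤ.+ r P₂ B)) (ℕ.*-distribˡ-+ k ∣ A ∣ ∣ B ∣) ⟩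
    (+ (k ℕ.* ∣ A ∣) ℤ.+ + (k ℕ.* ∣ B ∣)) ℤ.- (r P₁ A ℤ.+ r P₂ B)
      ≡⟨ +-[-]-interchange (+ (k ℕ.* ∣ A ∣)) (+ (k ℕ.* ∣ B ∣)) (r P₁ A) (r P₂ B) ⟩
    (+ (k ℕ.* ∣ A ∣) ℤ.- r P₁ A) ℤ.+ (+ (k ℕ.* ∣ B ∣) ℤ.- r P₂ B)
      ≡⟨ cong₂ ℤ._+_ (+nullity P₁ isK₁ A⊆E₁) (+nullity P₂ isK₂ B⊆E₂) ⟨
    + (nullity k P₁ A ℕ.+ nullity k P₂ B) ∎)
    where open ≡.≡-Reasoning

-- The semiring of bivariate polynomials and multiplicativity.

ℤ[x,y]-commutativeSemiring : CommutativeSemiring _ _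
ℤ[x,y]-commutativeSemiring = record
  { isCommutativeSemiring =
      -- The inner application adjoins `x` to the integers, the outer one adjoins `y`.
      PolynomialSemiring.≈ₚ-isCommutativeSemiring ℤ[x]
        (PolynomialSemiring.≈ₚ-isCommutativeSemiring ℤ.+-*-rawRing
          ℤ.+-*-isCommutativeSemiring)
  }

proposition3p4 : ∀ {N} (k : ℕ) → 1 ≤ k → (P₁ P₂ : Polymatroid N) →
    IsKPolymatroid k P₁ → IsKPolymatroid k P₂ → Disjoint P₁ P₂ →
    T k (P₁ ⊕ P₂) ≈ T k P₁ * T k P₂
proposition3p4 {N} k _ P₁ P₂ isK₁ isK₂ disjoint =
  -- Each `T` unfolds definitionally to the sum of `weight` over `subsetsOf` its groundset, so the
  -- factorisation applies without conversion.
  ∑-∪-* (E P₁) (E P₂) disjoint (weight (P₁ ⊕ P₂)) (weight P₁) (weight P₂) weight-⊕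
  where
  open SubsetSum ℤ[x,y]-commutativeSemiring

  monomial : ℕ → ℕ → Poly₂
  monomial m n = (x + - 1#) ^ m * (y + - 1#) ^ n

  weight : Polymatroid N → Subset N → Poly₂
  weight P A = monomial (corank P A) (nullity k P A)

  weight-⊕ : ∀ A B → A ⊆ E P₁ → B ⊆ E P₂ →
    weight (P₁ ⊕ P₂) (A ∪ B) ≈ weight P₁ A * weight P₂ B
  weight-⊕ A B A⊆E₁ B⊆E₂
    -- The exponents agree as natural numbers, so the claim is transported from the split exponents,
    -- where the power laws apply.
    = subst₂ (λ m n → monomial m n ≈ weight P₁ A * weight P₂ B)
        (≡.sym (corank-⊕ P₁ P₂ disjoint A⊆E₁ B⊆E₂))
        (≡.sym (nullity-⊕ P₁ P₂ disjoint A⊆E₁ B⊆E₂ isK₁ isK₂))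
        (^-*-homo-* (x + - 1#) (y + - 1#)
          (corank P₁ A) (corank P₂ B) (nullity k P₁ A) (nullity k P₂ B))
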